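{- Let $p>0$ and $\Delta\ge 3$ be integers, and let $G=(V,E)$ be a finite graph with maximum degree $\Delta(G)\le\Delta$. Then \[ {\rm mad}(G^{p})\le \frac{\Delta}{\Delta-2}\cdot 2\left\lfloor\frac{p+1}{2}\right\rfloor\cdot {\rm wcol}_{\lceil p/2\rceil}(G)\cdot(\Delta-1)^{\lfloor p/2\rfloor}. \]
   Context: For a graph $G$, ${\rm dist}_G(x,y)$ is the length of a shortest $x,y$-path. The $p$-th power of $G=(V,E)$ is the graph $G^{p}=(V,E^{p})$ with $E^{p}=\{xy: 1\le {\rm dist}_{G}(x,y)\le p\}$. The maximum average degree is ${\rm mad}(H)=\max_{\emptyset\ne H'\subseteq H}\frac{2\|H'\|}{|H'|}$ (number of edges over number of vertices). For a total ordering $\sigma$ of $V$ and $x\in V$, let $V^{l}_\sigma[x]=\{y: y<_\sigma x\}\cup\{x\}$ and $V^{r}_\sigma[y]=\{z: y<_\sigma z\}\cup\{y\}$. A vertex $y$ is weakly $k$-reachable from $x$ with respect to $\sigma$ if $y\in V^{l}_\sigma[x]$ and there is an $x,y$-path $P$ in $G$ with at most $k$ edges and $V(P)\subseteq V^{r}_\sigma[y]$. Let $W^{k}_\sigma[x]$ be the set of vertices weakly $k$-reachable from $x$. The weak $k$-coloring number is ${\rm wcol}_k(G)=\min_{\sigma}\max_{x\in V}|W^{k}_\sigma[x]|$, the minimum over all total orderings $\sigma$ of $V$. -}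

module Defs where

open import Data.Nat using (ℕ; zero; suc; _+_; _*_; _≤_; _<ᵇ_; _≤ᵇ_; _⊔_)
open import Data.Bool using (Bool; true; false; _∧_; _∨_; not; if_then_else_)
open import Data.Fin using (Fin; toℕ)
open import Data.Fin.Properties using (_≟_)
open import Data.List using (List; map; allFin; foldr)
open import Data.Nat.ListAction using (sum)
open import Data.Bool.ListAction using (any)
open import Data.Product using (Σ; ∃; _×_)
open import Data.Fin.Permutation using (Permutation′; _⟨$⟩ʳ_)
open import Relation.Nullary.Decidable using (⌊_⌋)
open import Relation.Binary.PropositionalEquality using (_≡_)

record Graph (n : ℕ) : Set where
  field
    adj    : Fin n → Fin n → Bool
    sym    : ∀ x y → adj x y ≡ adj y x
    irrefl : ∀ x → adj x x ≡ false
open Graph public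

_==_ : ∀ {n} → Fin n → Fin n → Bool
x == y = ⌊ x ≟ y ⌋

count : ∀ {n} → (Fin n → Bool) → ℕ
count {n} f = sum (map (λ x → if f x then 1 else 0) (allFin n))

anyV : ∀ {n} → (Fin n → Bool) → Bool
anyV {n} f = any f (allFin n)

degree : ∀ {n} → Graph n → Fin n → ℕ
degree G x = count (adj G x)

MaxDegreeAtMost : ∀ {n} → Graph n → ℕ → Set
MaxDegreeAtMost G D = ∀ x → degree G x ≤ D

-- reachWithin G A k x y = true  iff there is an x,y-walk in G with at most
-- k edges all of whose vertices (including x and y) satisfy A.
-- (Equivalently: an x,y-path with at most k edges inside A.)
reachWithin : ∀ {n} → Graph n → (Fin n → Bool) → ℕ → Fin n → Fin n → Bool
reachWithin G A zero    x y = A x ∧ (x == y)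
reachWithin G A (suc k) x y =
  reachWithin G A k x y ∨ (A y ∧ anyV (λ z → reachWithin G A k x z ∧ adj G z y))

distAtMost : ∀ {n} → Graph n → ℕ → Fin n → Fin n → Bool
distAtMost G k x y = reachWithin G (λ _ → true) k x y

powAdj : ∀ {n} → Graph n → ℕ → Fin n → Fin n → Bool
powAdj G p x y = not (x == y) ∧ distAtMost G p x y

inducedEdges : ∀ {n} → (Fin n → Fin n → Bool) → (Fin n → Bool) → ℕ
inducedEdges a S =
  sum (map (λ x → count (λ y → S x ∧ S y ∧ (toℕ x <ᵇ toℕ y) ∧ a x y)) (allFin _))

-- mad(H) ≤ num / den, for H with adjacency `a`, den > 0 assumed by users:
-- every nonempty (induced, w.l.o.g.) subgraph H' has 2‖H'‖/|H'| ≤ num/den,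
-- written with denominators cleared.
MadAtMost : ∀ {n} → (Fin n → Fin n → Bool) → ℕ → ℕ → Set
MadAtMost {n} a num den =
  ∀ (S : Fin n → Bool) → (∃ λ x → S x ≡ true) →
    2 * inducedEdges a S * den ≤ num * count S

-- A total ordering σ of V, encoded as a permutation: x <_σ y iff pos σ x < pos σ y.
pos : ∀ {n} → Permutation′ n → Fin n → ℕ
pos σ x = toℕ (σ ⟨$⟩ʳ x)

weaklyReach : ∀ {n} → Graph n → Permutation′ n → ℕ → Fin n → Fin n → Bool
weaklyReach G σ k x y =
  (pos σ y ≤ᵇ pos σ x) ∧ reachWithin G (λ z → pos σ y ≤ᵇ pos σ z) k x y

wreachSize : ∀ {n} → Graph n → Permutation′ n → ℕ → Fin n → ℕ
wreachSize G σ k x = count (weaklyReach G σ k x)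

-- max_x |W^k_σ[x]|  (0 for the empty graph)
maxWreach : ∀ {n} → Graph n → Permutation′ n → ℕ → ℕ
maxWreach {n} G σ k = foldr _⊔_ 0 (map (wreachSize G σ k) (allFin n))

IsWcol : ∀ {n} → Graph n → ℕ → ℕ → Set
IsWcol G k w =
  (∃ λ (σ : Permutation′ _) → maxWreach G σ k ≡ w) ×
  (∀ (σ : Permutation′ _) → w ≤ maxWreach G σ k)

{-# OPTIONS --safe #-}

-- Fix an ordering σ attaining w = wcol_k and write m = ⌊p/2⌋, k = ⌈p/2⌉.  An edge xy of G^p is
-- realised by a geodesic v₀ … v_l from x to y with l ≤ p.  If v_t is σ-minimal on a window
-- v_t … v_{t+l-m} with t ≤ m, then x is found from y by going out to distance m - t, picking one of
-- w weakly k-reachable vertices, and going out to distance t; there are at most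
-- w Δ(Δ-1)^m/(Δ-2) such triples for each t.
--
-- For odd p the σ-minimum of the geodesic, read from the nearer end, gives such a t in 0 … m = k - 1.
-- For even p that would be one t too many.  There take instead the minimum of the interior
-- v₁ … v_{l-1}: it yields some 1 ≤ t < m unless it is the middle of a path of length 2m, and
-- then each half of the path gives a window at t = 0 or at t = m.  So t = 0 and t = m may be
-- weighted by one half.  For t = m the sphere is enlarged to a ball, which also absorbs the
-- pairs at distance at most m.
module Submission where

open import Defs renaming (sym to adj-sym)
open import Data.Bool using (Bool; true; false; _∧_; _∨_; not; if_then_else_; T; T?)
open import Data.Bool.Properties using (T-∧; T-∨; T-≡)
open import Data.Empty using (⊥-elim)
open import Data.Fin using (Fin; zero; suc; toℕ)
open import Data.Fin.Permutation using (Permutation′)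
open import Data.List using (List; []; _∷_; map; allFin; foldr)
open import Data.List.Membership.Propositional using (_∈_; find; lose)
open import Data.List.Membership.Propositional.Properties using (∈-allFin)
open import Data.List.Properties using (map-tabulate)
open import Data.List.Relation.Unary.Any using (here; there)
open import Data.List.Relation.Unary.Any.Properties using (any⁺; any⁻)
open import Data.Nat using (ℕ; zero; suc; _+_; _*_; _∸_; _^_; _⊔_; _≤_; _<_; z≤n; s≤s; _≤?_; _<ᵇ_; _≤ᵇ_; ⌊_/2⌋; ⌈_/2⌉)
open import Data.Nat.ListAction using (sum)
open import Data.Nat.Properties
open import Data.Nat.Tactic.RingSolver using (solve-∀)
open import Data.Product using (∃; ∃₂; _×_; _,_; proj₁; proj₂)
open import Data.Sum using (_⊎_; inj₁; inj₂)
open import Function using (_∘_; id)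
open import Function.Bundles using (module Equivalence)
open import Relation.Binary.PropositionalEquality using (_≡_; refl; sym; trans; cong; cong₂; subst; subst₂)
open import Relation.Nullary using (¬_; yes; no)
open import Relation.Nullary.Decidable using (fromWitness; toWitness)

private
  variable
    n : ℕ
    a b : Bool

*-left-comm : ∀ a b c → a * (b * c) ≡ b * (a * c)
*-left-comm = solve-∀

-- Boolean connectives as propositions

∧⁺ : T a → T b → T (a ∧ b)
∧⁺ p q = Equivalence.from T-∧ (p , q)

∧⁻ : T (a ∧ b) → T a × T b
∧⁻ = Equivalence.to T-∧

∨⁺ : T a ⊎ T b → T (a ∨ b)
∨⁺ = Equivalence.from T-∨

∨⁻ : T (a ∨ b) → T a ⊎ T b
∨⁻ = Equivalence.to T-∨

not⁺ : ¬ T a → T (not a)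
not⁺ {true}  ¬p = ¬p _
not⁺ {false} _  = _

not⁻ : T (not a) → ¬ T a
not⁻ {true} ()

anyV⁺ : (f : Fin n → Bool) (x : Fin n) → T (f x) → T (anyV f)
anyV⁺ f x fx = any⁺ f (lose (∈-allFin x) fx)

anyV⁻ : (f : Fin n → Bool) → T (anyV f) → ∃ λ x → T (f x)
anyV⁻ f p = let x , _ , fx = find (any⁻ f (allFin _) p) in x , fx

==-refl : (x : Fin n) → T (x == x)
==-refl x = fromWitness refl

==⇒≡ : (x y : Fin n) → T (x == y) → x ≡ y
==⇒≡ x y = toWitness

-- Sums over the vertex set

ι : Bool → ℕ
ι b = if b then 1 else 0

ι-true : T b → ι b ≡ 1
ι-true {true} _ = refl

ι-≤ : ∀ {c} → (T b → 1 ≤ c) → ι b ≤ c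
ι-≤ {true}  h = h _
ι-≤ {false} h = z≤n

ι-split : ∀ a b → ι a ≤ ι b + ι (a ∧ not b)
ι-split false _     = z≤n
ι-split true  true  = ≤-refl
ι-split true  false = ≤-refl

module _ {A : Set} where

  sumOver : List A → (A → ℕ) → ℕ
  sumOver xs f = sum (map f xs)

  sumOver-mono : ∀ xs {f g : A → ℕ} → (∀ x → f x ≤ g x) → sumOver xs f ≤ sumOver xs g
  sumOver-mono []       h = z≤n
  sumOver-mono (x ∷ xs) h = +-mono-≤ (h x) (sumOver-mono xs h)

  sumOver-+ : ∀ xs (f g : A → ℕ) → sumOver xs (λ x → f x + g x) ≡ sumOver xs f + sumOver xs g
  sumOver-+ []       f g = refl
  sumOver-+ (x ∷ xs) f g rewrite sumOver-+ xs f g = lemma (f x) (g x) (sumOver xs f) (sumOver xs g)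
    where
    lemma : ∀ a b c d → a + b + (c + d) ≡ a + c + (b + d)
    lemma = solve-∀

  sumOver-*ˡ : ∀ xs c (f : A → ℕ) → sumOver xs (λ x → c * f x) ≡ c * sumOver xs f
  sumOver-*ˡ []       c f = sym (*-zeroʳ c)
  sumOver-*ˡ (x ∷ xs) c f rewrite sumOver-*ˡ xs c f = sym (*-distribˡ-+ c (f x) (sumOver xs f))

  ≤-sumOver : ∀ {xs x} (f : A → ℕ) → x ∈ xs → f x ≤ sumOver xs f
  ≤-sumOver {xs = x ∷ xs} f (here refl) = m≤m+n (f x) _
  ≤-sumOver {xs = x ∷ xs} f (there p)   = ≤-trans (≤-sumOver f p) (m≤n+m _ (f x))

  sumOver-0 : ∀ xs → sumOver xs (λ (_ : A) → 0) ≡ 0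
  sumOver-0 []       = refl
  sumOver-0 (x ∷ xs) = sumOver-0 xs

sumOver-swap : ∀ {A B : Set} (xs : List A) (ys : List B) (f : A → B → ℕ) →
  sumOver xs (λ x → sumOver ys (f x)) ≡ sumOver ys (λ y → sumOver xs (λ x → f x y))
sumOver-swap []       ys f = sym (sumOver-0 ys)
sumOver-swap (x ∷ xs) ys f rewrite sumOver-swap xs ys f =
  sym (sumOver-+ ys (f x) (λ y → sumOver xs (λ x → f x y)))

∑ : (Fin n → ℕ) → ℕ
∑ {n} = sumOver (allFin n)

∑-mono : {f g : Fin n → ℕ} → (∀ x → f x ≤ g x) → ∑ f ≤ ∑ g
∑-mono = sumOver-mono (allFin _)

∑-+ : (f g : Fin n → ℕ) → ∑ (λ x → f x + g x) ≡ ∑ f + ∑ g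
∑-+ = sumOver-+ (allFin _)

∑-*ˡ : ∀ c (f : Fin n → ℕ) → ∑ (λ x → c * f x) ≡ c * ∑ f
∑-*ˡ = sumOver-*ˡ (allFin _)

∑-swap : (f : Fin n → Fin n → ℕ) → ∑ (λ x → ∑ (f x)) ≡ ∑ (λ y → ∑ (λ x → f x y))
∑-swap = sumOver-swap (allFin _) (allFin _)

≤-∑ : (f : Fin n → ℕ) (x : Fin n) → f x ≤ ∑ f
≤-∑ f x = ≤-sumOver f (∈-allFin x)

count-unique : (P : Fin n → Bool) → (∀ x y → T (P x) → T (P y) → x ≡ y) → count P ≤ 1
count-unique {zero}  P u = z≤n
count-unique {suc n} P u = subst (_≤ 1) (sym eq) bound
  where
  tail : ℕ
  tail = ∑ (ι ∘ P ∘ suc)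

  -- `allFin (suc n)` is `zero` followed by a tabulation of `suc`, so the remaining summands are
  -- re-indexed over `allFin n`.
  eq : count P ≡ ι (P zero) + tail
  eq = cong (λ xs → ι (P zero) + sum xs)
    (trans (map-tabulate suc (ι ∘ P)) (sym (map-tabulate id (ι ∘ P ∘ suc))))

  tail-unique : tail ≤ 1
  tail-unique = count-unique (P ∘ suc) λ x y px py → suc-inj (u (suc x) (suc y) px py)
    where
    suc-inj : ∀ {x y : Fin n} → _≡_ {A = Fin (suc n)} (suc x) (suc y) → x ≡ y
    suc-inj refl = refl

  bound : ι (P zero) + tail ≤ 1
  bound with P zero in p₀
  ... | false = tail-unique
  ... | true  = s≤s (≤-trans (∑-mono none) (≤-reflexive (sumOver-0 (allFin n))))
    where
    none : ∀ x → ι (P (suc x)) ≤ 0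
    none x with P (suc x) in pₓ
    ... | false = z≤n
    ... | true with () ← u zero (suc x) (Equivalence.from T-≡ p₀) (Equivalence.from T-≡ pₓ)

-- Composition of ℕ-valued kernels on the vertex set

Kernel : ℕ → Set
Kernel n = Fin n → Fin n → ℕ

_⨾_ : Kernel n → Kernel n → Kernel n
(F ⨾ H) x z = ∑ λ y → F x y * H y z

-- Expand along the middle vertex: each `y` contributes `F x y` times a row sum of `H`. The factor
-- `d` stays with the later kernel because ball sizes are bounded only after multiplication by Δ -
-- 2.
⨾-row : (F H : Kernel n) (d : ℕ) {f h : ℕ} (x : Fin n) →
  ∑ (F x) ≤ f → (∀ y → d * ∑ (H y) ≤ h) → d * ∑ ((F ⨾ H) x) ≤ h * f
⨾-row F H d {f} {h} x F≤ H≤ = begin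
  d * ∑ (λ z → ∑ λ y → F x y * H y z)  ≡⟨ cong (d *_) (∑-swap (λ z y → F x y * H y z)) ⟩
  d * ∑ (λ y → ∑ λ z → F x y * H y z)  ≡⟨ ∑-*ˡ d (λ y → ∑ λ z → F x y * H y z) ⟨
  ∑ (λ y → d * ∑ λ z → F x y * H y z)  ≤⟨ ∑-mono row ⟩
  ∑ (λ y → h * F x y)                  ≡⟨ ∑-*ˡ h (F x) ⟩
  h * ∑ (F x)                          ≤⟨ *-monoʳ-≤ h F≤ ⟩
  h * f                                ∎
  where
  open ≤-Reasoning
  row : ∀ y → d * ∑ (λ z → F x y * H y z) ≤ h * F x y
  row y = begin
    d * ∑ (λ z → F x y * H y z)  ≡⟨ cong (d *_) (∑-*ˡ (F x y) (H y)) ⟩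
    d * (F x y * ∑ (H y))        ≡⟨ *-left-comm d (F x y) (∑ (H y)) ⟩
    F x y * (d * ∑ (H y))        ≤⟨ *-monoʳ-≤ (F x y) (H≤ y) ⟩
    F x y * h                    ≡⟨ *-comm (F x y) h ⟩
    h * F x y                    ∎

⨾-pos : (F H : Kernel n) (x y z : Fin n) → 1 ≤ F x y → 1 ≤ H y z → 1 ≤ (F ⨾ H) x z
⨾-pos F H x y z p q = ≤-trans (*-mono-≤ p q) (≤-∑ (λ y → F x y * H y z) y)

ιₖ : (Fin n → Fin n → Bool) → Kernel n
ιₖ A x y = ι (A x y)

-- The entry at `y`, `x` counts the pairs `u`, `z` with `A y u`, `B u z` and `C z x`.
via : (A B C : Fin n → Fin n → Bool) → Kernel n
via A B C = ιₖ A ⨾ (ιₖ B ⨾ ιₖ C)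

via-pos : (A B C : Fin n → Fin n → Bool) (y u z x : Fin n) →
  T (A y u) → T (B u z) → T (C z x) → 1 ≤ via A B C y x
via-pos A B C y u z x p q r =
  ⨾-pos (ιₖ A) (ιₖ B ⨾ ιₖ C) y u x (pos-ι p) (⨾-pos (ιₖ B) (ιₖ C) u z x (pos-ι q) (pos-ι r))
  where
  pos-ι : ∀ {b} → T b → 1 ≤ ι b
  pos-ι t = ≤-reflexive (sym (ι-true t))

via-row : (A B C : Fin n → Fin n → Bool) (d : ℕ) {f g h : ℕ} (y : Fin n) →
  count (A y) ≤ f → (∀ u → count (B u) ≤ g) → (∀ z → d * count (C z) ≤ h) →
  d * ∑ (via A B C y) ≤ h * g * f
via-row A B C d y A≤ B≤ C≤ =
  ⨾-row (ιₖ A) (ιₖ B ⨾ ιₖ C) d y A≤ λ u → ⨾-row (ιₖ B) (ιₖ C) d u (B≤ u) C≤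

-- Double counting of edges by charges

-- Discharging: an edge inside `S` is worth two units, which its two ends pay, while a vertex pays
-- at most `K / d` altogether.
inducedEdges-charging : (a : Fin n → Fin n → Bool) (c : Kernel n) (d K : ℕ) →
  (∀ x y → T (a x y) → 2 ≤ c x y + c y x) →
  (∀ x → d * ∑ (c x) ≤ K) →
  ∀ S → 2 * inducedEdges a S * d ≤ K * count S
inducedEdges-charging {n} a c d K pays cheap S = begin
  2 * inducedEdges a S * d
    ≡⟨ *-comm (2 * inducedEdges a S) d ⟩
  d * (2 * inducedEdges a S)
    ≤⟨ *-monoʳ-≤ d twice ⟩
  d * ∑ (λ x → ι (S x) * ∑ (c x))
    ≡⟨ ∑-*ˡ d (λ x → ι (S x) * ∑ (c x)) ⟨
  ∑ (λ x → d * (ι (S x) * ∑ (c x)))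
    ≤⟨ ∑-mono (λ x → ≤-trans (≤-reflexive (*-left-comm d (ι (S x)) (∑ (c x)))) (≤-trans (*-monoʳ-≤ (ι (S x)) (cheap x)) (≤-reflexive (*-comm (ι (S x)) K)))) ⟩
  ∑ (λ x → K * ι (S x))
    ≡⟨ ∑-*ˡ K (ι ∘ S) ⟩
  K * count S ∎
  where
  open ≤-Reasoning

  lt : Fin n → Fin n → Bool
  lt x y = toℕ x <ᵇ toℕ y

  -- `inducedEdges` lists an edge once, from its end of smaller index. The payments of `x` are split
  -- by the index of the other end, so that `up x y` and `down y x` are what the two ends of a
  -- listed edge pay.
  up down : Kernel n
  up   x y = ι (lt x y) * (ι (S x) * c x y)
  down x y = ι (lt y x) * (ι (S x) * c x y)

  edge : ∀ x y → 2 * ι (S x ∧ S y ∧ lt x y ∧ a x y) ≤ up x y + down y x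
  edge x y with S x | S y | lt x y | a x y in axy
  ... | false | _     | _     | _     = z≤n
  ... | true  | false | _     | _     = z≤n
  ... | true  | true  | false | _     = z≤n
  ... | true  | true  | true  | false = z≤n
  ... | true  | true  | true  | true  = ≤-trans (pays x y (Equivalence.from T-≡ axy))
          (≤-reflexive (cong₂ _+_ (one (c x y)) (one (c y x))))
    where
    one : ∀ m → m ≡ 1 * (1 * m)
    one = solve-∀

  once : ∀ x y → up x y + down x y ≤ ι (S x) * c x y
  once x y with lt x y in p | lt y x in q
  ... | true  | true  = ⊥-elim (<-asym (<ᵇ⇒< (toℕ x) (toℕ y) (Equivalence.from T-≡ p)) (<ᵇ⇒< (toℕ y) (toℕ x) (Equivalence.from T-≡ q)))
  ... | true  | false = ≤-reflexive (trans (+-identityʳ _) (+-identityʳ _))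
  ... | false | true  = ≤-reflexive (+-identityʳ _)
  ... | false | false = z≤n

  twice : 2 * inducedEdges a S ≤ ∑ (λ x → ι (S x) * ∑ (c x))
  twice = begin
    2 * ∑ (λ x → ∑ (λ y → E x y))           ≡⟨ ∑-*ˡ 2 (λ x → ∑ (E x)) ⟨
    ∑ (λ x → 2 * ∑ (E x))                   ≤⟨ ∑-mono (λ x → ≤-trans (≤-reflexive (sym (∑-*ˡ 2 (E x)))) (≤-trans (∑-mono (edge x)) (≤-reflexive (∑-+ (up x) (λ y → down y x))))) ⟩
    ∑ (λ x → ∑ (up x) + ∑ (λ y → down y x)) ≡⟨ ∑-+ (λ x → ∑ (up x)) (λ x → ∑ (λ y → down y x)) ⟩
    -- Transposing books the payment of the larger end in that end's own row.
    ∑ (λ x → ∑ (up x)) + ∑ (λ x → ∑ (λ y → down y x)) ≡⟨ cong (∑ (λ x → ∑ (up x)) +_) (∑-swap (λ x y → down y x)) ⟩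
    ∑ (λ x → ∑ (up x)) + ∑ (λ x → ∑ (down x)) ≡⟨ ∑-+ (λ x → ∑ (up x)) (λ x → ∑ (down x)) ⟨
    ∑ (λ x → ∑ (up x) + ∑ (down x))         ≤⟨ ∑-mono (λ x → ≤-trans (≤-reflexive (sym (∑-+ (up x) (down x)))) (≤-trans (∑-mono (once x)) (≤-reflexive (∑-*ˡ (ι (S x)) (c x))))) ⟩
    ∑ (λ x → ι (S x) * ∑ (c x))             ∎
    where
    E : Kernel n
    E x y = ι (S x ∧ S y ∧ lt x y ∧ a x y)

-- Bounds on reachability sets and on products of sphere sizes

wreachSize≤maxWreach : (G : Graph n) (σ : Permutation′ n) (k : ℕ) (x : Fin n) →
  wreachSize G σ k x ≤ maxWreach G σ k
wreachSize≤maxWreach {n} G σ k x = go (∈-allFin x)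
  where
  go : ∀ {xs} → x ∈ xs → wreachSize G σ k x ≤ foldr _⊔_ 0 (map (wreachSize G σ k) xs)
  go (here refl)       = m≤m⊔n _ _
  go (there {y} x∈xs) = m≤n⇒m≤o⊔n (wreachSize G σ k y) (go x∈xs)

-- The bound Δ (Δ - 1)^(r-1) on the number of vertices at distance r, with Δ = 2 + e.
sphereBound : ℕ → ℕ → ℕ
sphereBound e zero    = 1
sphereBound e (suc r) = (2 + e) * (1 + e) ^ r

-- Comes down to Δ(Δ - 2) ≤ (Δ - 1)² when both radii are positive, and to Δ - 2 ≤ Δ - 1 when `t` is
-- zero.
sphereBound-* : ∀ e s t → 0 < s →
  e * (sphereBound e t * sphereBound e s) ≤ (2 + e) * (1 + e) ^ (s + t)
sphereBound-* e (suc s) zero _ = begin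
  e * (1 * ((2 + e) * (1 + e) ^ s))        ≤⟨ *-monoˡ-≤ _ (n≤1+n e) ⟩
  (1 + e) * (1 * ((2 + e) * (1 + e) ^ s))  ≡⟨ lemma (1 + e) (2 + e) ((1 + e) ^ s) ⟩
  (2 + e) * (1 + e) ^ suc s                ≡⟨ cong (λ k → (2 + e) * (1 + e) ^ k) (+-identityʳ (suc s)) ⟨
  (2 + e) * (1 + e) ^ (suc s + 0)          ∎
  where
  open ≤-Reasoning
  lemma : ∀ a b c → a * (1 * (b * c)) ≡ b * (a * c)
  lemma = solve-∀
sphereBound-* e (suc s) (suc t) _ = begin
  e * ((2 + e) * (1 + e) ^ t * ((2 + e) * (1 + e) ^ s))
    -- The added summand is the gap (Δ - 1)² - Δ(Δ - 2) = 1 times the common factor.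
    ≤⟨ m≤m+n _ ((2 + e) * ((1 + e) ^ s * (1 + e) ^ t)) ⟩
  e * ((2 + e) * (1 + e) ^ t * ((2 + e) * (1 + e) ^ s)) + (2 + e) * ((1 + e) ^ s * (1 + e) ^ t)
    ≡⟨ lemma e ((1 + e) ^ s) ((1 + e) ^ t) ⟩
  (2 + e) * ((1 + e) ^ suc s * (1 + e) ^ suc t)
    ≡⟨ cong ((2 + e) *_) (^-distribˡ-+-* (1 + e) (suc s) (suc t)) ⟨
  (2 + e) * (1 + e) ^ (suc s + suc t) ∎
  where
  open ≤-Reasoning
  lemma : ∀ e p q → e * ((2 + e) * q * ((2 + e) * p)) + (2 + e) * (p * q) ≡ (2 + e) * ((1 + e) * p * ((1 + e) * q))
  lemma = solve-∀

-- Reachability and distance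

module _ (G : Graph n) where

  reach-suc : ∀ A k x y → T (reachWithin G A k x y) → T (reachWithin G A (suc k) x y)
  reach-suc A k x y p = ∨⁺ (inj₁ p)

  reach-mono : ∀ A {j k} x y → j ≤ k → T (reachWithin G A j x y) → T (reachWithin G A k x y)
  reach-mono A {j} {k} x y j≤k p = subst (λ k → T (reachWithin G A k x y)) (m∸n+n≡m j≤k) (go (k ∸ j))
    where
    go : ∀ d → T (reachWithin G A (d + j) x y)
    go zero    = p
    go (suc d) = reach-suc A (d + j) x y (go d)

  reach-step : ∀ A k x z y → T (reachWithin G A k x z) → T (adj G z y) → T (A y) → T (reachWithin G A (suc k) x y)
  reach-step A k x z y p e Ay = ∨⁺ {reachWithin G A k x y}
    (inj₂ (∧⁺ Ay (anyV⁺ (λ z → reachWithin G A k x z ∧ adj G z y) z (∧⁺ p e))))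

  reach-case : ∀ A k x y → T (reachWithin G A (suc k) x y) →
    T (reachWithin G A k x y) ⊎ ∃ λ z → T (reachWithin G A k x z) × T (adj G z y)
  reach-case A k x y p with ∨⁻ {reachWithin G A k x y} p
  ... | inj₁ q = inj₁ q
  ... | inj₂ q =
    let z , r = anyV⁻ (λ z → reachWithin G A k x z ∧ adj G z y) (proj₂ (∧⁻ {A y} q))
    in inj₂ (z , ∧⁻ {reachWithin G A k x z} r)

  adj-symT : ∀ x y → T (adj G x y) → T (adj G y x)
  adj-symT x y = subst T (adj-sym G x y)

  Near : ℕ → Fin n → Fin n → Set
  Near k x y = T (distAtMost G k x y)

  near-refl : ∀ x → Near 0 x x
  near-refl = ==-refl

  near-mono : ∀ {j k} x y → j ≤ k → Near j x y → Near k x y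
  near-mono = reach-mono (λ _ → true)

  near-step : ∀ k x z y → Near k x z → T (adj G z y) → Near (suc k) x y
  near-step k x z y p e = reach-step (λ _ → true) k x z y p e _

  near-case : ∀ k x y → Near (suc k) x y → Near k x y ⊎ ∃ λ z → Near k x z × T (adj G z y)
  near-case = reach-case (λ _ → true)

  near-trans : ∀ i j x y z → Near i x y → Near j y z → Near (i + j) x z
  near-trans i zero x y z p q rewrite ==⇒≡ y z q = subst (λ i → Near i x z) (sym (+-identityʳ i)) p
  near-trans i (suc j) x y z p q with near-case j y z q
  ... | inj₁ r = near-mono x z (+-monoʳ-≤ i (n≤1+n j)) (near-trans i j x y z p r)
  ... | inj₂ (u , r , e) = subst (λ k → Near k x z) (sym (+-suc i j))
          (near-step (i + j) x u z (near-trans i j x y u p r) e)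

  near-sym : ∀ k x y → Near k x y → Near k y x
  near-sym zero x y p rewrite ==⇒≡ x y p = near-refl y
  near-sym (suc k) x y p with near-case k x y p
  ... | inj₁ q = near-mono y x (n≤1+n k) (near-sym k x y q)
  ... | inj₂ (z , q , e) = near-trans 1 k y z x
          (near-step 0 y y z (near-refl y) (adj-symT z y e)) (near-sym k x z q)

  -- Sizes of spheres and balls

  sphere : ℕ → Fin n → Fin n → Bool
  sphere zero    x y = distAtMost G 0 x y
  sphere (suc r) x y = distAtMost G (suc r) x y ∧ not (distAtMost G r x y)

  AtDistance : ℕ → Fin n → Fin n → Set
  AtDistance r x y = Near r x y × (∀ d → Near d x y → r ≤ d)

  sphere⁺ : ∀ r x y → AtDistance r x y → T (sphere r x y)
  sphere⁺ zero    x y (p , _) = p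
  sphere⁺ (suc r) x y (p , q) = ∧⁺ p (not⁺ λ e → <-irrefl refl (q r e))

  sphere⇒near : ∀ r x y → T (sphere r x y) → Near r x y
  sphere⇒near zero    x y p = p
  sphere⇒near (suc r) x y p = proj₁ (∧⁻ {distAtMost G (suc r) x y} p)

  near⇒atDistance : ∀ k x y → Near k x y → ∃ λ r → r ≤ k × AtDistance r x y
  near⇒atDistance zero x y p = 0 , z≤n , p , λ _ _ → z≤n
  near⇒atDistance (suc k) x y p with T? (distAtMost G k x y)
  ... | yes q = let r , r≤k , at = near⇒atDistance k x y q in r , m≤n⇒m≤1+n r≤k , at
  ... | no ¬q = suc k , ≤-refl , p , λ d e → ≰⇒> λ d≤k → ¬q (near-mono x y d≤k e)

  -- On a shortest path the vertex before `y` cannot be closer to `x` than `r`, since one more step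
  -- would then bring `y` within `r`.
  sphere-pred : ∀ r x y → T (sphere (suc r) x y) → ∃ λ z → T (sphere r x z) × T (adj G z y)
  sphere-pred r x y p with ∧⁻ {distAtMost G (suc r) x y} p
  ... | q , ¬q with near-case r x y q
  ...   | inj₁ q′ = ⊥-elim (not⁻ ¬q q′)
  ...   | inj₂ (z , q′ , e) = z , lemma r q′ (not⁻ ¬q) , e
    where
    lemma : ∀ r → Near r x z → ¬ Near r x y → T (sphere r x z)
    lemma zero    q′ _  = q′
    lemma (suc r) q′ ¬q = ∧⁺ q′ (not⁺ λ s → ¬q (near-step r x z y s e))

  -- For `z` on the sphere of radius `r` these are its neighbours on the next sphere.
  outward : ℕ → Fin n → Fin n → Fin n → Bool
  outward r x z y = adj G z y ∧ not (distAtMost G r x y)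

  -- Every vertex of the next sphere is an outward neighbour of some vertex of this one; such pairs
  -- are counted from the inner end.
  count-sphere-suc : ∀ r x d → (∀ z → T (sphere r x z) → count (outward r x z) ≤ d) →
    count (sphere (suc r) x) ≤ d * count (sphere r x)
  count-sphere-suc r x d few = begin
    ∑ (λ y → ι (sphere (suc r) x y))  ≤⟨ ∑-mono (λ y → ι-≤ (through y)) ⟩
    ∑ (λ y → ∑ λ z → K z y)           ≡⟨ ∑-swap (λ y z → K z y) ⟩
    ∑ (λ z → ∑ λ y → K z y)           ≤⟨ ∑-mono (λ z → ≤-trans (≤-reflexive (∑-*ˡ (ι (sphere r x z)) (ι ∘ outward r x z))) (row z)) ⟩
    ∑ (λ z → d * ι (sphere r x z))    ≡⟨ ∑-*ˡ d (ι ∘ sphere r x) ⟩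
    d * count (sphere r x)            ∎
    where
    open ≤-Reasoning
    K : Kernel n
    K z y = ι (sphere r x z) * ι (outward r x z y)

    through : ∀ y → T (sphere (suc r) x y) → 1 ≤ ∑ (λ z → K z y)
    through y p with sphere-pred r x y p
    ... | z , q , e = ≤-trans
      (≤-reflexive (sym (cong₂ _*_ (ι-true q) (ι-true (∧⁺ e (proj₂ (∧⁻ {distAtMost G (suc r) x y} p)))))))
      (≤-∑ (λ z → K z y) z)

    -- `few` applies only on the sphere; elsewhere the factor `ι (sphere r x z)` is zero.
    row : ∀ z → ι (sphere r x z) * count (outward r x z) ≤ d * ι (sphere r x z)
    row z with sphere r x z in eq
    ... | false = z≤n
    ... | true  = subst₂ _≤_ (sym (+-identityʳ _)) (sym (*-identityʳ d)) (few z (Equivalence.from T-≡ eq))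

  outward≤degree : ∀ r x z → count (outward r x z) ≤ degree G z
  outward≤degree r x z = ∑-mono λ y → ι-≤ λ p → ≤-reflexive (sym (ι-true (proj₁ (∧⁻ {adj G z y} p))))

  -- The predecessor of z on a geodesic from x is a neighbour that is not outward.
  outward<degree : ∀ r x z → T (sphere (suc r) x z) → count (outward (suc r) x z) < degree G z
  outward<degree r x z p with sphere-pred r x z p
  ... | u , q , e = begin-strict
    count (outward (suc r) x z)                              <⟨ n<1+n _ ⟩
    1 + count (outward (suc r) x z)                          ≤⟨ +-monoˡ-≤ _ inward-pos ⟩
    count inward + count (outward (suc r) x z)               ≡⟨ ∑-+ (ι ∘ inward) (ι ∘ outward (suc r) x z) ⟨
    ∑ (λ y → ι (inward y) + ι (outward (suc r) x z y))       ≤⟨ ∑-mono split ⟩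
    degree G z                                               ∎
    where
    open ≤-Reasoning
    inward : Fin n → Bool
    inward y = adj G z y ∧ distAtMost G (suc r) x y

    inward-pos : 1 ≤ count inward
    inward-pos = ≤-trans
      (≤-reflexive (sym (ι-true (∧⁺ (adj-symT u z e) (near-mono x u (n≤1+n r) (sphere⇒near r x u q))))))
      (≤-∑ (ι ∘ inward) u)

    split : ∀ y → ι (inward y) + ι (outward (suc r) x z y) ≤ ι (adj G z y)
    split y with adj G z y | distAtMost G (suc r) x y
    ... | false | _     = z≤n
    ... | true  | true  = ≤-refl
    ... | true  | false = ≤-refl

  count-sphere-zero : ∀ x → count (sphere 0 x) ≤ 1
  count-sphere-zero x = count-unique (sphere 0 x) λ y z p q → trans (sym (==⇒≡ x y p)) (==⇒≡ x z q)

  module _ {e : ℕ} (maxdeg : MaxDegreeAtMost G (2 + e)) where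

    -- The centre may send all Δ edges outward, whereas every later vertex keeps one for its
    -- predecessor, which leaves Δ - 1.
    count-sphere : ∀ r x → count (sphere r x) ≤ sphereBound e r
    count-sphere 0 x = count-sphere-zero x
    count-sphere 1 x = begin
      count (sphere 1 x)            ≤⟨ count-sphere-suc 0 x (2 + e) (λ z _ → ≤-trans (outward≤degree 0 x z) (maxdeg z)) ⟩
      (2 + e) * count (sphere 0 x)  ≤⟨ *-monoʳ-≤ (2 + e) (count-sphere-zero x) ⟩
      (2 + e) * 1                   ∎
      where open ≤-Reasoning
    count-sphere (suc (suc r)) x = begin
      count (sphere (2 + r) x)            ≤⟨ count-sphere-suc (suc r) x (1 + e) (λ z p → ≤-pred (≤-trans (outward<degree r x z p) (maxdeg z))) ⟩
      (1 + e) * count (sphere (suc r) x)  ≤⟨ *-monoʳ-≤ (1 + e) (count-sphere (suc r) x) ⟩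
      (1 + e) * ((2 + e) * (1 + e) ^ r)   ≡⟨ *-left-comm (1 + e) (2 + e) ((1 + e) ^ r) ⟩
      (2 + e) * (1 + e) ^ suc r           ∎
      where open ≤-Reasoning

    -- The summand 2 makes the geometric sum inductive.
    count-ball : ∀ r x → 2 + e * count (distAtMost G r x) ≤ (2 + e) * (1 + e) ^ r
    count-ball zero x = begin
      2 + e * count (sphere 0 x)  ≤⟨ +-monoʳ-≤ 2 (*-monoʳ-≤ e (count-sphere-zero x)) ⟩
      2 + e * 1                   ≡⟨ lemma e ⟩
      (2 + e) * 1                 ∎
      where
      open ≤-Reasoning
      lemma : ∀ e → 2 + e * 1 ≡ (2 + e) * 1
      lemma = solve-∀
    count-ball (suc r) x = begin
      2 + e * count (distAtMost G (suc r) x)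
        ≤⟨ +-monoʳ-≤ 2 (*-monoʳ-≤ e (≤-trans (∑-mono (λ y → ι-split (distAtMost G (suc r) x y) (distAtMost G r x y))) (≤-reflexive (∑-+ (ι ∘ distAtMost G r x) (ι ∘ sphere (suc r) x))))) ⟩
      2 + e * (count (distAtMost G r x) + count (sphere (suc r) x))
        ≡⟨ regroup e (count (distAtMost G r x)) (count (sphere (suc r) x)) ⟩
      2 + e * count (distAtMost G r x) + e * count (sphere (suc r) x)
        ≤⟨ +-mono-≤ (count-ball r x) (*-monoʳ-≤ e (count-sphere (suc r) x)) ⟩
      (2 + e) * (1 + e) ^ r + e * ((2 + e) * (1 + e) ^ r)
        ≡⟨ collect e ((1 + e) ^ r) ⟩
      (2 + e) * (1 + e) ^ suc r ∎
      where
      open ≤-Reasoning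
      regroup : ∀ e a b → 2 + e * (a + b) ≡ 2 + e * a + e * b
      regroup = solve-∀
      collect : ∀ e q → (2 + e) * q + e * ((2 + e) * q) ≡ (2 + e) * ((1 + e) * q)
      collect = solve-∀

-- Minima over intervals of indices

argmin : (f : ℕ → ℕ) (lo d : ℕ) →
  ∃ λ q → lo ≤ q × q ≤ d + lo × (∀ i → lo ≤ i → i ≤ d + lo → f q ≤ f i)
argmin f lo zero = lo , ≤-refl , ≤-refl , λ i lo≤i i≤lo → ≤-reflexive (cong f (≤-antisym lo≤i i≤lo))
argmin f lo (suc d) with argmin f lo d
... | q , lo≤q , q≤ , min with ≤-total (f q) (f (suc d + lo))
...   | inj₁ fq≤ = q , lo≤q , m≤n⇒m≤1+n q≤ , case-last
  where
  case-last : ∀ i → lo ≤ i → i ≤ suc d + lo → f q ≤ f i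
  case-last i lo≤i i≤ with m≤n⇒m<n∨m≡n i≤
  ... | inj₁ (s≤s i≤′) = min i lo≤i i≤′
  ... | inj₂ refl      = fq≤
...   | inj₂ ≤fq = suc d + lo , m≤n+m lo (suc d) , ≤-refl , case-last
  where
  case-last : ∀ i → lo ≤ i → i ≤ suc d + lo → f (suc d + lo) ≤ f i
  case-last i lo≤i i≤ with m≤n⇒m<n∨m≡n i≤
  ... | inj₁ (s≤s i≤′) = ≤-trans ≤fq (min i lo≤i i≤′)
  ... | inj₂ refl      = ≤-refl

-- Geodesics

module _ (G : Graph n) where

  -- Only the values of `at` up to `l` matter; a total function keeps indexing free of bound proofs.
  record Walk (l : ℕ) (x y : Fin n) : Set where
    field
      at    : ℕ → Fin n
      start : at 0 ≡ x
      end   : at l ≡ y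
      step  : ∀ i → i < l → T (adj G (at i) (at (suc i)))
  open Walk

  walk-cons : ∀ {l x y z} → T (adj G x z) → Walk l z y → Walk (suc l) x y
  walk-cons {x = x} xz w .at zero = x
  walk-cons xz w .at (suc i) = at w i
  walk-cons xz w .start = refl
  walk-cons xz w .end = end w
  walk-cons {x = x} xz w .step zero _ = subst (λ z → T (adj G x z)) (sym (start w)) xz
  walk-cons xz w .step (suc i) (s≤s i<l) = step w i i<l

  walk-reverse : ∀ {l x y} → Walk l x y → Walk l y x
  walk-reverse {l} w .at i = at w (l ∸ i)
  walk-reverse w .start = end w
  walk-reverse {l} w .end = trans (cong (at w) (n∸n≡0 l)) (start w)
  walk-reverse {l} w .step i i<l = adj-symT G _ _
    (subst (λ j → T (adj G (at w (l ∸ suc i)) (at w j))) (sym l∸i) (step w (l ∸ suc i) (≤-trans (≤-reflexive (sym l∸i)) (m∸n≤m l i))))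
    where
    l∸i : l ∸ i ≡ suc (l ∸ suc i)
    l∸i = +-∸-assoc 1 i<l

  -- The walk comes out reversed because `reachWithin` grows at its second vertex whereas
  -- `walk-cons` prepends.
  near⇒walk : ∀ k x y → Near G k x y → ∃ λ l → l ≤ k × Walk l y x
  near⇒walk zero x y p = 0 , z≤n , record
    { at = λ _ → y ; start = refl ; end = sym (==⇒≡ x y p) ; step = λ _ () }
  near⇒walk (suc k) x y p with near-case G k x y p
  ... | inj₁ q = let l , l≤k , w = near⇒walk k x y q in l , m≤n⇒m≤1+n l≤k , w
  ... | inj₂ (z , q , zy) =
    let l , l≤k , w = near⇒walk k x z q in suc l , s≤s l≤k , walk-cons (adj-symT G z y zy) w

  -- The walk is read backwards, from the later vertex to the earlier one: this is the direction in
  -- which the lowest vertex of a window is weakly reached.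
  walk-reach : ∀ {l x y} (w : Walk l x y) A s d → s + d ≤ l → (∀ i → i ≤ d → T (A (at w (s + i)))) →
    T (reachWithin G A d (at w (s + d)) (at w s))
  walk-reach w A s zero _ inA = ∧⁺ (inA 0 z≤n) (subst (λ j → T (at w (s + 0) == at w j)) (+-identityʳ s) (==-refl _))
  walk-reach {l} w A s (suc d) s+d≤l inA = reach-step G A d _ (at w (suc s)) _
    (subst (λ j → T (reachWithin G A d (at w j) (at w (suc s)))) (sym (+-suc s d))
      (walk-reach w A (suc s) d s+d≤l′ λ i i≤d → subst (T ∘ A ∘ at w) (+-suc s i) (inA (suc i) (s≤s i≤d))))
    (adj-symT G _ _ (step w s (≤-trans (s≤s (m≤m+n s d)) s+d≤l′)))
    (subst (T ∘ A ∘ at w) (+-identityʳ s) (inA 0 z≤n))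
    where
    s+d≤l′ : suc s + d ≤ l
    s+d≤l′ = subst (_≤ l) (+-suc s d) s+d≤l

  walk-near : ∀ {l x y} (w : Walk l x y) s d → s + d ≤ l → Near G d (at w (s + d)) (at w s)
  walk-near w s d s+d≤l = walk-reach w (λ _ → true) s d s+d≤l λ _ _ → _

  Geodesic : ℕ → Fin n → Fin n → Set
  Geodesic l x y = Walk l x y × (∀ d → Near G d x y → l ≤ d)

  geodesic-reverse : ∀ {l x y} → Geodesic l x y → Geodesic l y x
  geodesic-reverse {l} {x} {y} (w , short) = walk-reverse w , λ d p → short d (near-sym G d y x p)

  near⇒geodesic : ∀ k x y → Near G k x y → ∃ λ l → l ≤ k × Geodesic l x y
  near⇒geodesic k x y p with near⇒atDistance G k x y p
  ... | l , l≤k , q , short with near⇒walk l y x (near-sym G l x y q)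
  ...   | l′ , l′≤l , w = l , l≤k , subst (λ l → Walk l x y) (≤-antisym l′≤l l≤l′) w , short
    where
    -- `near⇒walk` only bounds the length from above, but a shorter walk would witness a smaller
    -- distance.
    l≤l′ : l ≤ l′
    l≤l′ = short l′ (near-sym G l′ y x (subst₂ (Near G l′) (end w) (start w) (walk-near w 0 l′ ≤-refl)))

  -- A shorter connection, spliced between the two untouched ends, would shorten the whole walk.
  geodesic-segment : ∀ {l x y} (g : Geodesic l x y) i j → i + j ≤ l →
    AtDistance G j (at (proj₁ g) (i + j)) (at (proj₁ g) i)
  geodesic-segment {l} {x} {y} (w , short) i j i+j≤l = walk-near w i j i+j≤l , λ d p →
    +-cancelˡ-≤ i j d (+-cancelʳ-≤ r (i + j) (i + d) (≤-trans (≤-reflexive whole) (short _ (detour d p))))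
    where
    r : ℕ
    r = l ∸ (i + j)

    whole : i + j + r ≡ l
    whole = m+[n∸m]≡n i+j≤l

    detour : ∀ d → Near G d (at w (i + j)) (at w i) → Near G (i + d + r) x y
    detour d p = near-trans G (i + d) r x (at w (i + j)) y
      (near-trans G i d x (at w i) (at w (i + j))
        (subst (λ x → Near G i x (at w i)) (start w)
          (near-sym G i _ _ (walk-near w 0 i (≤-trans (m≤m+n i j) i+j≤l))))
        (near-sym G d _ _ p))
      (near-sym G r _ _ (subst (λ y → Near G r y (at w (i + j))) (trans (cong (at w) whole) (end w))
        (walk-near w (i + j) r (≤-reflexive whole))))

  -- Lowest vertices of geodesics

  module _ (σ : Permutation′ n) where

    height : ∀ {l x y} → Geodesic l x y → ℕ → ℕ
    height g i = pos σ (at (proj₁ g) i)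

    -- The range runs from `lo` to `l - lo`: `lo = 0` gives the whole geodesic, `lo = 1` its
    -- interior. Its symmetry lets it survive reversal.
    Lowest : ∀ {l x y} → Geodesic l x y → ℕ → ℕ → Set
    Lowest {l} g lo q = lo ≤ q × q + lo ≤ l × (∀ i → lo ≤ i → i + lo ≤ l → height g q ≤ height g i)

    lowest-exists : ∀ {l x y} (g : Geodesic l x y) lo → lo + lo ≤ l → ∃ (Lowest g lo)
    lowest-exists {l} g lo 2lo≤l with argmin (height g) lo (l ∸ (lo + lo))
    ... | q , lo≤q , q≤ , min = q , lo≤q , ≤-trans (+-monoˡ-≤ lo q≤) (≤-reflexive whole) ,
        λ i lo≤i i≤ → min i lo≤i (+-cancelʳ-≤ lo i _ (≤-trans i≤ (≤-reflexive (sym whole))))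
      where
      whole : l ∸ (lo + lo) + lo + lo ≡ l
      whole = trans (+-assoc (l ∸ (lo + lo)) lo lo) (m∸n+n≡m 2lo≤l)

    lowest-reverse : ∀ {l x y} (g : Geodesic l x y) lo q →
      Lowest g lo q → Lowest (geodesic-reverse g) lo (l ∸ q)
    lowest-reverse {l} g lo q (lo≤q , q+lo≤l , min) =
      lo≤l∸ q q+lo≤l , l∸+lo≤l q lo≤q q≤l , λ i lo≤i i+lo≤l →
        subst (λ j → height g j ≤ height g (l ∸ i)) (sym (m∸[m∸n]≡n q≤l))
          (min (l ∸ i) (lo≤l∸ i i+lo≤l) (l∸+lo≤l i lo≤i (≤-trans (m≤m+n i lo) i+lo≤l)))
      where
      q≤l : q ≤ l
      q≤l = ≤-trans (m≤m+n q lo) q+lo≤l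

      lo≤l∸ : ∀ i → i + lo ≤ l → lo ≤ l ∸ i
      lo≤l∸ i p = ≤-trans (≤-reflexive (sym (m+n∸m≡n i lo))) (∸-monoˡ-≤ i p)

      l∸+lo≤l : ∀ i → lo ≤ i → i ≤ l → l ∸ i + lo ≤ l
      l∸+lo≤l i lo≤i i≤l = ≤-trans (+-monoʳ-≤ (l ∸ i) lo≤i) (≤-reflexive (m∸n+n≡m i≤l))

    -- Charges and the kernels that count them

    module _ (m k : ℕ) where

      W : Fin n → Fin n → Bool
      W = weaklyReach G σ k

      Charge : ℕ → Fin n → Fin n → Set
      Charge t y x = ∃₂ λ u z → T (sphere G (m ∸ t) y u) × T (W u z) × T (sphere G t z x)

      -- With vertices v₀ = x, ..., v_l = y, take z = v_t and u = v_(t + l - m). The window between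
      -- them has l - m ≤ k edges and never goes below v_t, hence `W u z`; m - t edges remain from u
      -- to y.
      window-charge : ∀ {l x y} (g : Geodesic l x y) t → t ≤ m → m ≤ l → l ≤ m + k →
        (∀ i → i ≤ l ∸ m → height g t ≤ height g (t + i)) → Charge t y x
      window-charge {l} {x} {y} g@(w , _) t t≤m m≤l l≤m+k low =
        at w (t + c) , at w t ,
        sphere⁺ G (m ∸ t) _ _ (subst (λ y → AtDistance G (m ∸ t) y (at w (t + c)))
          (trans (cong (at w) whole) (end w)) (geodesic-segment g (t + c) (m ∸ t) (≤-reflexive whole))) ,
        ∧⁺ (≤⇒≤ᵇ (low c ≤-refl))
           (reach-mono G _ _ _ (m≤n+o⇒m∸n≤o l m l≤m+k)
             (walk-reach w _ t c (≤-trans (m≤m+n (t + c) (m ∸ t)) (≤-reflexive whole)) λ i i≤c → ≤⇒≤ᵇ (low i i≤c))) ,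
        sphere⁺ G t _ _ (subst (AtDistance G t (at w t)) (start w)
          (geodesic-segment g 0 t (≤-trans t≤m m≤l)))
        where
        c : ℕ
        c = l ∸ m

        whole : t + c + (m ∸ t) ≡ l
        whole = trans (cong (_+ (m ∸ t)) (+-comm t c))
          (trans (+-assoc c t (m ∸ t)) (trans (cong (c +_) (m+[n∸m]≡n t≤m)) (m∸n+n≡m m≤l)))

      -- The window starting at `q` ends at `q + (l - m)`, and `q + lo ≤ m` keeps that end within
      -- the range on which `q` is lowest.
      lowest-charge : ∀ {l x y} (g : Geodesic l x y) lo q → m ≤ l → l ≤ m + k →
        Lowest g lo q → q + lo ≤ m → Charge q y x
      lowest-charge {l} g lo q m≤l l≤m+k (lo≤q , _ , min) q+lo≤m =
        window-charge g q (≤-trans (m≤m+n q lo) q+lo≤m) m≤l l≤m+k λ i i≤ →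
          min (q + i) (≤-trans lo≤q (m≤m+n q i)) (begin
            q + i + lo        ≡⟨ lemma q i lo ⟩
            q + lo + i        ≤⟨ +-mono-≤ q+lo≤m i≤ ⟩
            m + (l ∸ m)       ≡⟨ m+[n∸m]≡n m≤l ⟩
            l                 ∎)
        where
        open ≤-Reasoning
        lemma : ∀ a b c → a + b + c ≡ a + c + b
        lemma = solve-∀

      slot : ℕ → Kernel n
      slot t = via (sphere G (m ∸ t)) W (sphere G t)

      ballSlot : Kernel n
      ballSlot = via (sphere G 0) W (distAtMost G m)

      slot-pos : ∀ t y x → Charge t y x → 1 ≤ slot t y x
      slot-pos t y x (u , z , p , q , r) = via-pos (sphere G (m ∸ t)) W (sphere G t) y u z x p q r

      ballSlot-charge : ∀ y x → Charge m y x → 1 ≤ ballSlot y x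
      ballSlot-charge y x (u , z , p , q , r) =
        via-pos (sphere G 0) W (distAtMost G m) y u z x (subst (λ i → T (sphere G i y u)) (n∸n≡0 m) p) q (sphere⇒near G m z x r)

      -- Take u = z = y: every vertex weakly reaches itself.
      ballSlot-near : ∀ y x → Near G m y x → 1 ≤ ballSlot y x
      ballSlot-near y x r = via-pos (sphere G 0) W (distAtMost G m) y y y x (near-refl G y)
        (∧⁺ y≤y (reach-mono G (λ z → pos σ y ≤ᵇ pos σ z) {0} {k} y y z≤n (∧⁺ y≤y (==-refl y)))) r
        where
        y≤y : T (pos σ y ≤ᵇ pos σ y)
        y≤y = ≤⇒≤ᵇ (≤-refl {pos σ y})

      module _ {e : ℕ} (maxdeg : MaxDegreeAtMost G (2 + e)) where

        slotBound : ℕ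
        slotBound = maxWreach G σ k * ((2 + e) * (1 + e) ^ m)

        -- `t < m` gives the first sphere a positive radius, as `sphereBound-*` asks. The case
        -- `t = m` is left to the ball.
        slot-row : ∀ t → t < m → ∀ y → e * ∑ (slot t y) ≤ slotBound
        slot-row t t<m y = begin
          e * ∑ (slot t y)
            ≤⟨ via-row (sphere G (m ∸ t)) W (sphere G t) e y (count-sphere G maxdeg (m ∸ t) y)
                 (wreachSize≤maxWreach G σ k) (λ z → *-monoʳ-≤ e (count-sphere G maxdeg t z)) ⟩
          e * sphereBound e t * maxWreach G σ k * sphereBound e (m ∸ t)
            ≡⟨ lemma e (sphereBound e t) (maxWreach G σ k) (sphereBound e (m ∸ t)) ⟩
          maxWreach G σ k * (e * (sphereBound e t * sphereBound e (m ∸ t)))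
            ≤⟨ *-monoʳ-≤ (maxWreach G σ k) (sphereBound-* e (m ∸ t) t (m<n⇒0<n∸m t<m)) ⟩
          maxWreach G σ k * ((2 + e) * (1 + e) ^ (m ∸ t + t))
            ≡⟨ cong (λ i → maxWreach G σ k * ((2 + e) * (1 + e) ^ i)) (m∸n+n≡m (<⇒≤ t<m)) ⟩
          slotBound ∎
          where
          open ≤-Reasoning
          lemma : ∀ a b c d → a * b * c * d ≡ c * (a * (b * d))
          lemma = solve-∀

        ballSlot-row : ∀ y → e * ∑ (ballSlot y) ≤ slotBound
        ballSlot-row y = begin
          e * ∑ (ballSlot y)
            ≤⟨ via-row (sphere G 0) W (distAtMost G m) e y (count-sphere-zero G y)
                 -- Dropping the summand 2 from `count-ball` leaves Δ(Δ - 1)^m, so this row obeys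
                 -- the same bound as the other slots.
                 (wreachSize≤maxWreach G σ k) (λ z → ≤-trans (m≤n+m _ 2) (count-ball G maxdeg m z)) ⟩
          (2 + e) * (1 + e) ^ m * maxWreach G σ k * 1
            ≡⟨ lemma ((2 + e) * (1 + e) ^ m) (maxWreach G σ k) ⟩
          slotBound ∎
          where
          open ≤-Reasoning
          lemma : ∀ a b → a * b * 1 ≡ b * a
          lemma = solve-∀

-- Summing the slots

sumBelow : ℕ → (ℕ → ℕ) → ℕ
sumBelow zero    f = 0
sumBelow (suc m) f = f m + sumBelow m f

≤-sumBelow : ∀ {m} f t → t < m → f t ≤ sumBelow m f
≤-sumBelow {suc m} f t (s≤s t≤m) with m≤n⇒m<n∨m≡n t≤m
... | inj₁ t<m  = ≤-trans (≤-sumBelow f t t<m) (m≤n+m _ (f m))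
... | inj₂ refl = m≤m+n (f m) _

sumBelow-row : ∀ m (K : ℕ → Fin n → ℕ) (d B : ℕ) → (∀ t → t < m → d * ∑ (K t) ≤ B) →
  d * ∑ (λ x → sumBelow m (λ t → K t x)) ≤ m * B
sumBelow-row {n} zero K d B h = ≤-reflexive (trans (cong (d *_) (sumOver-0 (allFin n))) (*-zeroʳ d))
sumBelow-row (suc m) K d B h = begin
  d * ∑ (λ x → K m x + sumBelow m (λ t → K t x))      ≡⟨ cong (d *_) (∑-+ (K m) _) ⟩
  d * (∑ (K m) + ∑ (λ x → sumBelow m (λ t → K t x)))  ≡⟨ *-distribˡ-+ d (∑ (K m)) _ ⟩
  d * ∑ (K m) + d * ∑ (λ x → sumBelow m (λ t → K t x)) ≤⟨ +-mono-≤ (h m ≤-refl) (sumBelow-row m K d B λ t t<m → h t (m≤n⇒m≤1+n t<m)) ⟩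
  B + m * B                                           ∎
  where open ≤-Reasoning

-- Charging schemes for odd and even powers

module _ (G : Graph n) (σ : Permutation′ n) {e : ℕ} (maxdeg : MaxDegreeAtMost G (2 + e)) where

  -- `m + k` stands for p, and `2 * k` for the factor 2⌊(p + 1)/2⌋.
  PowerCharging : ℕ → ℕ → Set
  PowerCharging m k = ∃ λ (c : Kernel n) →
    (∀ x y → Near G (m + k) x y → 2 ≤ c x y + c y x) ×
    (∀ x → e * ∑ (c x) ≤ 2 * k * slotBound G σ m k maxdeg)

  near-ends : ∀ {l x y} m → l ≤ m → Geodesic G l x y → Near G m y x
  near-ends {l} {x} {y} m l≤m (w , _) = near-mono G y x l≤m
    (subst₂ (Near G l) (Walk.end w) (Walk.start w) (walk-near G w 0 l ≤-refl))

  -- The `m` slots below `m` and the ball make `k` kernels. With weight 2 each they cost `2 * k` row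
  -- bounds, and a single hit pays for an edge.
  oddCharging : ∀ m → PowerCharging m (suc m)
  oddCharging m = c , pays , cheap
    where
    k : ℕ
    k = suc m

    below ball c : Kernel n
    below y x = sumBelow m (λ t → slot G σ m k t y x)
    ball      = ballSlot G σ m k
    c y x     = 2 * (below y x + ball y x)

    charged : ∀ t y x → t ≤ m → Charge G σ m k t y x → 2 ≤ c y x
    charged t y x t≤m ch with m≤n⇒m<n∨m≡n t≤m
    ... | inj₁ t<m  = *-monoʳ-≤ 2 (≤-trans (slot-pos G σ m k t y x ch)
                        (≤-trans (≤-sumBelow (λ t → slot G σ m k t y x) t t<m) (m≤m+n _ (ball y x))))
    ... | inj₂ refl = *-monoʳ-≤ 2 (≤-trans (ballSlot-charge G σ m k y x ch) (m≤n+m _ (below y x)))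

    pays : ∀ x y → Near G (m + k) x y → 2 ≤ c x y + c y x
    pays x y p with near⇒geodesic G (m + k) x y p
    ... | l , l≤p , g with l ≤? m
    ...   | yes l≤m = ≤-trans
              (*-monoʳ-≤ 2 (≤-trans (ballSlot-near G σ m k y x (near-ends m l≤m g)) (m≤n+m _ (below y x))))
              (m≤n+m _ (c x y))
    ...   | no l≰m with lowest-exists G σ g 0 z≤n
    ...     | q , low with q ≤? m
    ...       | yes q≤m = ≤-trans
                  (charged q y x q≤m (lowest-charge G σ m k g 0 q (≰⇒≥ l≰m) l≤p low (≤-trans (≤-reflexive (+-identityʳ q)) q≤m)))
                  (m≤n+m _ (c x y))
    -- As l ≤ 2m + 1, a lowest vertex beyond position m is within m steps of the other end.
    ...       | no q≰m = ≤-trans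
                  (charged (l ∸ q) x y l∸q≤m (lowest-charge G σ m k (geodesic-reverse G g) 0 (l ∸ q) (≰⇒≥ l≰m) l≤p
                    (lowest-reverse G σ g 0 q low) (≤-trans (≤-reflexive (+-identityʳ (l ∸ q))) l∸q≤m)))
                  (m≤m+n _ (c y x))
      where
      l∸q≤m : l ∸ q ≤ m
      l∸q≤m = m≤n+o⇒m∸n≤o l q (begin
        l          ≤⟨ l≤p ⟩
        m + suc m  ≡⟨ +-comm m (suc m) ⟩
        suc m + m  ≤⟨ +-monoˡ-≤ m (≰⇒> q≰m) ⟩
        q + m      ∎)
        where open ≤-Reasoning

    cheap : ∀ y → e * ∑ (c y) ≤ 2 * k * slotBound G σ m k maxdeg
    cheap y = begin
      e * ∑ (c y)                                        ≡⟨ cong (e *_) (trans (∑-*ˡ 2 (λ x → below y x + ball y x)) (cong (2 *_) (∑-+ (below y) (ball y)))) ⟩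
      e * (2 * (∑ (below y) + ∑ (ball y)))               ≡⟨ regroup e (∑ (below y)) (∑ (ball y)) ⟩
      2 * (e * ∑ (below y) + e * ∑ (ball y))             ≤⟨ *-monoʳ-≤ 2 (+-mono-≤
                                                              (sumBelow-row m (λ t → slot G σ m k t y) e B (λ t t<m → slot-row G σ m k maxdeg t t<m y))
                                                              (ballSlot-row G σ m k maxdeg y)) ⟩
      2 * (m * B + B)                                    ≡⟨ collect m B ⟩
      2 * k * B                                          ∎
      where
      open ≤-Reasoning
      B : ℕ
      B = slotBound G σ m k maxdeg
      regroup : ∀ e a b → e * (2 * (a + b)) ≡ 2 * (e * a + e * b)
      regroup = solve-∀
      collect : ∀ m B → 2 * (m * B + B) ≡ 2 * suc m * B
      collect = solve-∀

  -- Slots 1 to m - 1 get weight 2, slot 0 and the ball weight 1, so the cost is 2(m - 1) + 2 = 2m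
  -- row bounds.
  evenCharging : ∀ j → PowerCharging (suc j) (suc j)
  evenCharging j = c , pays , cheap
    where
    m : ℕ
    m = suc j

    inner first ball c : Kernel n
    inner y x = sumBelow j (λ t → slot G σ m m (suc t) y x)
    first     = slot G σ m m 0
    ball      = ballSlot G σ m m
    c y x     = first y x + ball y x + 2 * inner y x

    charged : ∀ t y x → 1 ≤ t → t + 1 ≤ m → Charge G σ m m t y x → 2 ≤ c y x
    charged (suc t) y x _ t<m ch = ≤-trans
      (*-monoʳ-≤ 2 (≤-trans (slot-pos G σ m m (suc t) y x ch)
        (≤-sumBelow (λ t → slot G σ m m (suc t) y x) t (≤-trans (≤-reflexive (+-comm 1 t)) (≤-pred t<m)))))
      (m≤n+m _ (first y x + ball y x))

    -- The lowest interior vertex is the middle one; compare it with the end y.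
    half : ∀ {x y} (g : Geodesic G (m + m) x y) → Lowest G σ g 1 m → 1 ≤ ball y x + first x y
    half {x} {y} g (_ , _ , min) with ≤-total (height G σ g m) (height G σ g (m + m))
    -- The middle is lowest on the whole second half, which is thus a window at t = m.
    ... | inj₁ mid≤ = ≤-trans
        (ballSlot-charge G σ m m y x (window-charge G σ m m g m ≤-refl (m≤m+n m m) ≤-refl λ i i≤ → window i (≤-trans i≤ (≤-reflexive (m+n∸m≡n m m)))))
        (m≤m+n _ (first x y))
      where
      window : ∀ i → i ≤ m → height G σ g m ≤ height G σ g (m + i)
      window i i≤m with m≤n⇒m<n∨m≡n i≤m
      ... | inj₁ i<m  = min (m + i) (s≤s z≤n) (≤-trans (≤-reflexive (trans (+-assoc m i 1) (cong (m +_) (+-comm i 1)))) (+-monoʳ-≤ m i<m))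
      ... | inj₂ refl = mid≤
    -- Now y is lowest on that half, a window at t = 0 of the reversed geodesic.
    ... | inj₂ ≤mid = ≤-trans
        (slot-pos G σ m m 0 x y (window-charge G σ m m (geodesic-reverse G g) 0 z≤n (m≤m+n m m) ≤-refl λ i i≤ → window i (≤-trans i≤ (≤-reflexive (m+n∸m≡n m m)))))
        (m≤n+m _ (ball y x))
      where
      window : ∀ i → i ≤ m → height G σ g (m + m) ≤ height G σ g (m + m ∸ i)
      window zero    _   = ≤-refl
      window (suc i) i<m = ≤-trans ≤mid (min (m + m ∸ suc i)
        (m<n⇒0<n∸m (≤-trans (s≤s i<m) (s≤s (m≤n+m m j))))
        (≤-trans (+-monoʳ-≤ (m + m ∸ suc i) (s≤s (z≤n {i}))) (≤-reflexive (m∸n+n≡m (≤-trans i<m (m≤m+n m m))))))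

    pays : ∀ x y → Near G (m + m) x y → 2 ≤ c x y + c y x
    pays x y p with near⇒geodesic G (m + m) x y p
    ... | l , l≤p , g with l ≤? m
    -- The ball has weight 1 only, so a close pair is paid once from either end.
    ...   | yes l≤m = +-mono-≤ (ballPart x y (ballSlot-near G σ m m x y (near-ends m l≤m (geodesic-reverse G g))))
                               (ballPart y x (ballSlot-near G σ m m y x (near-ends m l≤m g)))
      where
      ballPart : ∀ x y → 1 ≤ ball x y → 1 ≤ c x y
      ballPart x y h = ≤-trans h (≤-trans (m≤n+m _ (first x y)) (m≤m+n _ (2 * inner x y)))
    -- l > m ≥ 1 gives l ≥ 2, so there is an interior vertex.
    ...   | no l≰m with lowest-exists G σ g 1 (≤-trans (s≤s (s≤s z≤n)) (≰⇒> l≰m))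
    ...     | q , low@(1≤q , q+1≤l , _) with q + 1 ≤? m
    ...       | yes q<m = ≤-trans
                  (charged q y x 1≤q q<m (lowest-charge G σ m m g 1 q (≰⇒≥ l≰m) l≤p low q<m))
                  (m≤n+m _ (c x y))
    ...       | no q≮m with l ∸ q + 1 ≤? m
    ...         | yes q′<m = ≤-trans
                    (charged (l ∸ q) x y (proj₁ low′) q′<m
                      (lowest-charge G σ m m (geodesic-reverse G g) 1 (l ∸ q) (≰⇒≥ l≰m) l≤p low′ q′<m))
                    (m≤m+n _ (c y x))
      where
      low′ : Lowest G σ (geodesic-reverse G g) 1 (l ∸ q)
      low′ = lowest-reverse G σ g 1 q low
    -- Both q and l - q are at least m, so l ≤ 2m forces l = 2m and q = m.
    ...         | no q′≮m = middle l≡ q≡ g low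
      where
      m≤q : m ≤ q
      m≤q = ≤-pred (≤-trans (≰⇒> q≮m) (≤-reflexive (+-comm q 1)))

      m≤l∸q : m ≤ l ∸ q
      m≤l∸q = ≤-pred (≤-trans (≰⇒> q′≮m) (≤-reflexive (+-comm (l ∸ q) 1)))

      q≤l : q ≤ l
      q≤l = ≤-trans (m≤m+n q 1) q+1≤l

      l≡ : l ≡ m + m
      l≡ = ≤-antisym l≤p (≤-trans (+-mono-≤ m≤q m≤l∸q) (≤-reflexive (m+[n∸m]≡n q≤l)))

      q≡ : q ≡ m
      q≡ = ≤-antisym (+-cancelʳ-≤ m q m (≤-trans (+-monoʳ-≤ q m≤l∸q) (≤-trans (≤-reflexive (m+[n∸m]≡n q≤l)) l≤p))) m≤q

      -- Quantified over `l` and `q` so that both equations can be matched with `refl`.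
      middle : ∀ {l q} → l ≡ m + m → q ≡ m → (g : Geodesic G l x y) → Lowest G σ g 1 q → 2 ≤ c x y + c y x
      middle refl refl g low = begin
        -- The two directions are paid by four different summands, so nothing is counted twice.
        2                                                          ≤⟨ +-mono-≤ (half g low) (half (geodesic-reverse G g) low′) ⟩
        ball y x + first x y + (ball x y + first y x)              ≤⟨ m≤m+n _ (2 * inner x y + 2 * inner y x) ⟩
        ball y x + first x y + (ball x y + first y x) + (2 * inner x y + 2 * inner y x)
          ≡⟨ regroup (ball y x) (first x y) (ball x y) (first y x) (2 * inner x y) (2 * inner y x) ⟩
        c x y + c y x                                              ∎
        where
        open ≤-Reasoning
        low′ : Lowest G σ (geodesic-reverse G g) 1 m
        low′ = subst (Lowest G σ (geodesic-reverse G g) 1) (m+n∸m≡n m m) (lowest-reverse G σ g 1 m low)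
        regroup : ∀ a b c d i j → a + b + (c + d) + (i + j) ≡ b + c + i + (d + a + j)
        regroup = solve-∀

    cheap : ∀ y → e * ∑ (c y) ≤ 2 * m * slotBound G σ m m maxdeg
    cheap y = begin
      e * ∑ (c y)
        ≡⟨ cong (e *_) (trans (∑-+ (λ x → first y x + ball y x) (λ x → 2 * inner y x))
             (cong₂ _+_ (∑-+ (first y) (ball y)) (∑-*ˡ 2 (inner y)))) ⟩
      e * (∑ (first y) + ∑ (ball y) + 2 * ∑ (inner y))
        ≡⟨ regroup e (∑ (first y)) (∑ (ball y)) (∑ (inner y)) ⟩
      e * ∑ (first y) + e * ∑ (ball y) + 2 * (e * ∑ (inner y))
        ≤⟨ +-mono-≤ (+-mono-≤ (slot-row G σ m m maxdeg 0 (s≤s z≤n) y) (ballSlot-row G σ m m maxdeg y))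
             (*-monoʳ-≤ 2 (sumBelow-row j (λ t → slot G σ m m (suc t) y) e B λ t t<j → slot-row G σ m m maxdeg (suc t) (s≤s t<j) y)) ⟩
      B + B + 2 * (j * B)
        ≡⟨ collect j B ⟩
      2 * m * B ∎
      where
      open ≤-Reasoning
      B : ℕ
      B = slotBound G σ m m maxdeg
      regroup : ∀ e a b i → e * (a + b + 2 * i) ≡ e * a + e * b + 2 * (e * i)
      regroup = solve-∀
      collect : ∀ j B → B + B + 2 * (j * B) ≡ 2 * suc j * B
      collect = solve-∀

  -- `evenCharging` asks for a positive `m`, so two is peeled off p; p = 1 is the odd case with m =
  -- 0.
  charging : ∀ p → 0 < p → PowerCharging ⌊ p /2⌋ ⌈ p /2⌉
  charging 1 _ = oddCharging 0
  charging (suc (suc p)) _ with halves p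
    where
    halves : ∀ p → ⌈ p /2⌉ ≡ ⌊ p /2⌋ ⊎ ⌈ p /2⌉ ≡ suc ⌊ p /2⌋
    halves 0 = inj₁ refl
    halves 1 = inj₂ refl
    halves (suc (suc p)) with halves p
    ... | inj₁ eq = inj₁ (cong suc eq)
    ... | inj₂ eq = inj₂ (cong suc eq)
  ... | inj₁ eq = subst (PowerCharging (suc ⌊ p /2⌋)) (cong suc (sym eq)) (evenCharging ⌊ p /2⌋)
  ... | inj₂ eq = subst (PowerCharging (suc ⌊ p /2⌋)) (cong suc (sym eq)) (oddCharging (suc ⌊ p /2⌋))

-- The bound on the maximum average degree

theorem2p3 : (p Δ : ℕ) → 0 < p → 3 ≤ Δ →
    ∀ {n} (G : Graph n) → MaxDegreeAtMost G Δ →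
    (w : ℕ) → IsWcol G ⌈ p /2⌉ w →
    MadAtMost (powAdj G p)
    (Δ * (2 * ⌊ (p + 1) /2⌋) * w * (Δ ∸ 1) ^ ⌊ p /2⌋)
    (Δ ∸ 2)
-- Writing Δ = 2 + e makes Δ - 2 and Δ - 1 compute; `refl` replaces `w` by the maximum for an
-- ordering σ that attains it.
theorem2p3 p (suc (suc e)) 0<p (s≤s (s≤s _)) G maxdeg w ((σ , refl) , _) S _
  with charging G σ maxdeg p 0<p
... | c , pays , cheap =
  subst (λ K → 2 * inducedEdges (powAdj G p) S * e ≤ K * count S) constant
    (inducedEdges-charging (powAdj G p) c e _ edge cheap S)
  where
  edge : ∀ x y → T (powAdj G p x y) → 2 ≤ c x y + c y x
  edge x y xy = pays x y (subst (λ k → Near G k x y) (sym (⌊n/2⌋+⌈n/2⌉≡n p)) (proj₂ (∧⁻ {not (x == y)} xy)))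

  regroup : ∀ k w a b → 2 * k * (w * (a * b)) ≡ a * (2 * k) * w * b
  regroup = solve-∀

  constant : 2 * ⌈ p /2⌉ * (w * ((2 + e) * (1 + e) ^ ⌊ p /2⌋)) ≡ (2 + e) * (2 * ⌊ (p + 1) /2⌋) * w * (1 + e) ^ ⌊ p /2⌋
  -- `⌈ p /2⌉` unfolds to `⌊ suc p /2⌋`, so commuting `p + 1` identifies the two forms of the
  -- factor.
  constant rewrite +-comm p 1 = regroup ⌈ p /2⌉ w (2 + e) ((1 + e) ^ ⌊ p /2⌋)
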